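{- Consider SALIQUOT. Then $\mathcal{SG}(0)=0$. Suppose that $n>0$ and let $n=2^{k}m$, where $2\nmid m$ and $k\ge 0$. Then $\mathcal{SG}(n)= v(n)+1=k+1$.
   Context: SALIQUOT is the impartial normal-play game on the nonnegative integers where from $n$ a player subtracts a positive divisor of $n$, i.e. $\mathrm{opt}(n)=\{n-d: d\mid n,\ d>0\}$ (so $0$ has no options); the player unable to move loses. $\mathcal{SG}$ denotes the Sprague-Grundy value, defined by the mex rule. $v(n)$ is the 2-adic valuation of $n$. -}

module Defs where

open import Data.List.Base using (List; map; filter; upTo)
open import Data.List.Extrema.Nat using (max; xs≤max)
open import Data.List.Membership.DecPropositional using () renaming (_∈?_ to mem?)
open import Data.List.Membership.Propositional using (_∈_; _∉_; mapWith∈)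
open import Data.List.Membership.Propositional.Properties using (∈-map⁻; ∈-map⁺; ∈-filter⁻; ∈-filter⁺; ∈-upTo⁺; ∈-upTo⁻; mapWith∈-cong; mapWith∈≗map)
open import Data.List.Relation.Unary.All using (lookup)
open import Data.Nat.Base using (ℕ; zero; suc; _+_; _∸_; _^_; _≤_; _<_; _>_; z≤n; s≤s; NonZero)
open import Data.Nat.Divisibility using (_∣_; _∣?_; ∣⇒≤; 1∣_)
open import Data.Nat.Induction using (<-wellFounded; <-rec)
open import Data.Nat.Properties using (_≟_; ≤-trans; <-irrefl; m<1+n⇒m<n∨m≡n; ∸-monoʳ-<; m∸n+n≡m; m≤n+m; m+n∸n≡m; +-suc; m≤n⇒m<n∨m≡n; ≤-pred; +-identityʳ; +-mono-≤; m^n>0)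
open import Data.Product.Base using (∃; _×_; _,_; proj₁)
open import Data.Sum.Base using (inj₁; inj₂)
open import Function.Bundles using (_⇔_; mk⇔; module Equivalence)
open import Induction.WellFounded using (module FixPoint)
open import Relation.Binary.PropositionalEquality using (_≡_; refl; sym; trans; cong; subst)
open import Relation.Nullary.Decidable.Core using (yes; no)
open import Relation.Nullary.Negation.Core using (contradiction)

IsMex : List ℕ → ℕ → Set
IsMex xs m = m ∉ xs × (∀ j → j < m → j ∈ xs)

mex∃ : (xs : List ℕ) → ∃ (IsMex xs)
mex∃ xs = search (suc (max 0 xs)) 0 (λ _ ())
            (λ b∈ → <-irrefl refl (bounded b∈))
  where
  bounded : ∀ {x} → x ∈ xs → x < suc (max 0 xs) + 0
  bounded x∈ = s≤s (subst (_ ≤_) (sym (+-identityʳ _)) (lookup (xs≤max 0 xs) x∈))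

  search : ∀ gap i → (∀ j → j < i → j ∈ xs) → gap + i ∉ xs → ∃ (IsMex xs)
  search zero      i below i∉ = i , i∉ , below
  search (suc gap) i below top∉ with mem? _≟_ i xs
  ... | no i∉  = i , i∉ , below
  ... | yes i∈ = search gap (suc i) below′ (subst (_∉ xs) (sym (+-suc gap i)) top∉)
    where
    below′ : ∀ j → j < suc i → j ∈ xs
    below′ j j<1+i with m<1+n⇒m<n∨m≡n j<1+i
    ... | inj₁ j<i  = below j j<i
    ... | inj₂ refl = i∈

mex : List ℕ → ℕ
mex xs = proj₁ (mex∃ xs)

module SpragueGrundy
  (opt : ℕ → List ℕ)
  (opt-< : ∀ {n p} → p ∈ opt n → p < n)
  where

  private
    step : ∀ n → (∀ {p} → p < n → ℕ) → ℕ
    step n sg = mex (mapWith∈ (opt n) (λ p∈ → sg (opt-< p∈)))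

    step-ext : ∀ n {f g : ∀ {p} → p < n → ℕ} →
               (∀ {p} (p<n : p < n) → f p<n ≡ g p<n) → step n f ≡ step n g
    step-ext n eq = cong mex (mapWith∈-cong (opt n) _ _ (λ p∈ → eq (opt-< p∈)))

  SG : ℕ → ℕ
  SG = <-rec (λ _ → ℕ) step

  SG-mex : ∀ n → SG n ≡ mex (map SG (opt n))
  SG-mex n = trans (FixPoint.unfold-wfRec <-wellFounded (λ _ → ℕ) step step-ext)
                   (cong mex (mapWith∈≗map SG (opt n)))

-- For n > 0 the bound d ≤ n is automatic; at n = 0 it excludes every d > 0
-- (all of which divide 0), so that opt 0 is empty.
divisors : ℕ → List ℕ
divisors n = filter (_∣? n) (map suc (upTo n))

∈-divisors : ∀ n d → d ∈ divisors n ⇔ (d > 0 × d ∣ n × d ≤ n)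
∈-divisors n d = mk⇔ to from
  where
  to : d ∈ divisors n → d > 0 × d ∣ n × d ≤ n
  to d∈ with ∈-filter⁻ (_∣? n) {xs = map suc (upTo n)} d∈
  ... | d∈′ , d∣n with ∈-map⁻ suc d∈′
  ... | i , i∈ , refl = s≤s z≤n , d∣n , ∈-upTo⁻ i∈

  from : d > 0 × d ∣ n × d ≤ n → d ∈ divisors n
  from (s≤s _ , d∣n , d≤n) = ∈-filter⁺ (_∣? n) (∈-map⁺ suc (∈-upTo⁺ d≤n)) d∣n

opt : ℕ → List ℕ
opt n = map (n ∸_) (divisors n)

opt-< : ∀ {n p} → p ∈ opt n → p < n
opt-< {n} p∈ with ∈-map⁻ (n ∸_) p∈
... | d , d∈ , refl with Equivalence.to (∈-divisors n d) d∈
... | d>0 , _ , d≤n = ∸-monoʳ-< {n} {d} {0} d>0 d≤n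

∈-opt : ∀ n p → p ∈ opt n ⇔ (∃ λ d → d > 0 × d ∣ n × p + d ≡ n)
∈-opt n p = mk⇔ to from
  where
  to : p ∈ opt n → ∃ λ d → d > 0 × d ∣ n × p + d ≡ n
  to p∈ with ∈-map⁻ (n ∸_) p∈
  ... | d , d∈ , refl with Equivalence.to (∈-divisors n d) d∈
  ... | d>0 , d∣n , d≤n = d , d>0 , d∣n , m∸n+n≡m d≤n

  from : (∃ λ d → d > 0 × d ∣ n × p + d ≡ n) → p ∈ opt n
  from (d , d>0 , d∣n , refl) =
    subst (_∈ opt (p + d)) (m+n∸n≡m p d)
      (∈-map⁺ ((p + d) ∸_) (Equivalence.from (∈-divisors (p + d) d)
        (d>0 , d∣n , m≤n+m d p)))

open SpragueGrundy opt opt-< public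

IsValuation₂ : ℕ → ℕ → Set
IsValuation₂ n k = 2 ^ k ∣ n × (∀ j → 2 ^ j ∣ n → j ≤ k)

valuation∃ : ∀ n .{{_ : NonZero n}} → ∃ (IsValuation₂ n)
valuation∃ n = search n (λ j 2^j∣n → ≤-trans (j≤2^j j) (∣⇒≤ 2^j∣n))
  where
  j≤2^j : ∀ j → j ≤ 2 ^ j
  j≤2^j zero    = z≤n
  j≤2^j (suc j) = +-mono-≤ (m^n>0 2 j) (subst (j ≤_) (sym (+-identityʳ (2 ^ j))) (j≤2^j j))

  search : ∀ k → (∀ j → 2 ^ j ∣ n → j ≤ k) → ∃ (IsValuation₂ n)
  search zero    above = 0 , 1∣ n , above
  search (suc k) above with 2 ^ suc k ∣? n
  ... | yes 2^k∣n = suc k , 2^k∣n , above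
  ... | no  2^k∤n = search k above′
    where
    above′ : ∀ j → 2 ^ j ∣ n → j ≤ k
    above′ j 2^j∣n with m≤n⇒m<n∨m≡n (above j 2^j∣n)
    ... | inj₁ j<1+k = ≤-pred j<1+k
    ... | inj₂ refl  = contradiction 2^j∣n 2^k∤n

v : ∀ n .{{_ : NonZero n}} → ℕ
v n = proj₁ (valuation∃ n)

{-# OPTIONS --safe #-}

-- By strong induction, the options p = n − d of n > 0 realise the value 0 (d = n) and every value j + 1
-- with j < v(n) (d = 2^j, since v(n − 2^j) = j). The value v(n) + 1 is missed: if v(p) = v(n) = k,
-- then 2^k divides d, and p = c d, n = (c + 1) d. One of c, c + 1 is even, so 2^(k+1) divides p or n.

module Submission where

open import Defs
open import Data.List.Base using (map)
open import Data.List.Membership.Propositional using (_∈_; _∉_)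
open import Data.List.Membership.Propositional.Properties using (∈-map⁺; ∈-map⁻)
open import Data.Nat.Base using (ℕ; zero; suc; _+_; _*_; _∸_; _^_; _≤_; _<_; _>_; s≤s; z<s; s<s⁻¹; NonZero; >-nonZero)
open import Data.Nat.Divisibility using (_∣_; _∤_; divides-refl; ∣-refl; ∣-trans; ∣⇒≤; _∣0; 1∣_; m∣m*n; *-pres-∣; *-cancelˡ-∣; ∣m+n∣m⇒∣n; ∣m∣n⇒∣m+n)
open import Data.Nat.Induction using (<-rec)
open import Data.Nat.Properties using (<-cmp; <⇒≤; ≤-antisym; ≮⇒≥; n≮n; n<1+n; ≤⇒≯; +-comm; *-comm; suc-injective; m∸n+n≡m; m^n>0; m^n≢0; ^-monoʳ-<)
open import Data.Product.Base using (∃; _×_; _,_; proj₁; proj₂)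
open import Data.Sum.Base using (_⊎_; inj₁; inj₂)
open import Function.Base using (case_of_)
open import Function.Bundles using (module Equivalence)
open import Relation.Binary.Definitions using (tri<; tri≈; tri>)
open import Relation.Binary.PropositionalEquality using (_≡_; _≢_; refl; sym; trans; cong; subst)
open import Relation.Nullary.Negation.Core using (¬_; contradiction)

-- If two mexes differed, the smaller would lie below the larger and so belong to the list.
IsMex-unique : ∀ {xs m n} → IsMex xs m → IsMex xs n → m ≡ n
IsMex-unique {m = m} {n} (m∉ , below-m) (n∉ , below-n) with <-cmp m n
... | tri< m<n _ _ = contradiction (below-n m m<n) m∉
... | tri≈ _ m≡n _ = m≡n
... | tri> _ _ n<m = contradiction (below-m n n<m) n∉

SG-unique : ∀ {n g} → IsMex (map SG (opt n)) g → SG n ≡ g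
SG-unique {n} isMex = trans (SG-mex n) (IsMex-unique (proj₂ (mex∃ (map SG (opt n)))) isMex)

IsValuation₂-unique : ∀ {n j k} → IsValuation₂ n j → IsValuation₂ n k → j ≡ k
IsValuation₂-unique (2^j∣n , max-j) (2^k∣n , max-k) = ≤-antisym (max-k _ 2^j∣n) (max-j _ 2^k∣n)

2^-mono-∣ : ∀ {j k} → j ≤ k → 2 ^ j ∣ 2 ^ k
2^-mono-∣ {zero}          _         = 1∣ _
2^-mono-∣ {suc j} {suc k} (s≤s j≤k) = *-pres-∣ (∣-refl {2}) (2^-mono-∣ j≤k)

-- Failure at the next power suffices: for j > k, 2^(k+1) divides 2^j, so 2^j cannot divide n
-- either.
IsValuation₂-intro : ∀ {n k} → 2 ^ k ∣ n → 2 ^ suc k ∤ n → IsValuation₂ n k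
IsValuation₂-intro 2^k∣n 2^1+k∤n =
  2^k∣n , λ j 2^j∣n → ≮⇒≥ λ k<j → 2^1+k∤n (∣-trans (2^-mono-∣ k<j) 2^j∣n)

2^1+k∤n : ∀ {n k} → IsValuation₂ n k → 2 ^ suc k ∤ n
2^1+k∤n {k = k} (_ , max-k) 2^1+k∣n = n≮n k (max-k (suc k) 2^1+k∣n)

-- Every power of 2 divides 0, so no exponent is maximal there.
IsValuation₂⇒>0 : ∀ {n k} → IsValuation₂ n k → n > 0
IsValuation₂⇒>0 {zero}  val = contradiction (_ ∣0) (2^1+k∤n val)
IsValuation₂⇒>0 {suc _} _   = z<s

IsValuation₂-2^k*odd : ∀ k {m} → 2 ∤ m → IsValuation₂ (2 ^ k * m) k
IsValuation₂-2^k*odd k {m} 2∤m = IsValuation₂-intro (m∣m*n m) λ 2^1+k∣ →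
  2∤m (*-cancelˡ-∣ (2 ^ k) {{m^n≢0 2 k}} (subst (_∣ 2 ^ k * m) (*-comm 2 (2 ^ k)) 2^1+k∣))

2∣n⊎2∣1+n : ∀ n → 2 ∣ n ⊎ 2 ∣ suc n
2∣n⊎2∣1+n zero = inj₁ (2 ∣0)
2∣n⊎2∣1+n (suc n) with 2∣n⊎2∣1+n n
... | inj₁ 2∣n   = inj₂ (∣m∣n⇒∣m+n (∣-refl {2}) 2∣n)
... | inj₂ 2∣1+n = inj₁ 2∣1+n

option-changes-valuation : ∀ {n p k} → p ∈ opt n → IsValuation₂ n k → ¬ IsValuation₂ p k
option-changes-valuation {n} {p} {k} p∈ val-n val-p with Equivalence.to (∈-opt n p) p∈
-- From d ∣ p + d follows d ∣ p; its quotient is the `c` whose parity decides the case.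
... | d , _ , d∣n , refl with ∣m+n∣m⇒∣n (subst (d ∣_) (+-comm p d) d∣n) ∣-refl
...   | divides-refl c = case 2∣n⊎2∣1+n c of λ
  { (inj₁ 2∣c)   → 2^1+k∤n val-p (*-pres-∣ 2∣c 2^k∣d)
  ; (inj₂ 2∣1+c) → 2^1+k∤n val-n (subst (2 ^ suc k ∣_) (+-comm d (c * d)) (*-pres-∣ 2∣1+c 2^k∣d))
  }
  where
  2^k∣d : 2 ^ k ∣ d
  2^k∣d = ∣m+n∣m⇒∣n (proj₁ val-n) (proj₁ val-p)

-- The move subtracts 2^j. As j < k, 2^(j+1) divides n; if it also divided n - 2^j, it would divide
-- the difference 2^j, which is smaller.
option-of-smaller-valuation : ∀ {n j k} → IsValuation₂ n k → j < k → ∃ λ p → p ∈ opt n × IsValuation₂ p j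
option-of-smaller-valuation {n} {j} {k} val@(2^k∣n , _) j<k =
  p , Equivalence.from (∈-opt n p) (2 ^ j , m^n>0 2 j , 2^j∣n , p+2^j≡n) ,
  IsValuation₂-intro (∣m+n∣m⇒∣n (subst (2 ^ j ∣_) n≡2^j+p 2^j∣n) ∣-refl) 2^1+j∤p
  where
  -- Needed by `∣⇒≤`: n > 0 gives 2^j ≤ n, so the truncated subtraction is exact; 2^j > 0 gives the
  -- final contradiction.
  instance
    _ = >-nonZero (IsValuation₂⇒>0 val)
    _ = m^n≢0 2 j

  p = n ∸ 2 ^ j

  2^j∣n : 2 ^ j ∣ n
  2^j∣n = ∣-trans (2^-mono-∣ (<⇒≤ j<k)) 2^k∣n

  p+2^j≡n : p + 2 ^ j ≡ n
  p+2^j≡n = m∸n+n≡m (∣⇒≤ 2^j∣n)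

  n≡2^j+p : n ≡ 2 ^ j + p
  n≡2^j+p = trans (sym p+2^j≡n) (+-comm p (2 ^ j))

  2^1+j∤p : 2 ^ suc j ∤ p
  2^1+j∤p 2^1+j∣p = ≤⇒≯ (∣⇒≤ 2^1+j∣2^j) (^-monoʳ-< 2 (n<1+n 1) (n<1+n j))
    where
    2^1+j∣2^j : 2 ^ suc j ∣ 2 ^ j
    2^1+j∣2^j = ∣m+n∣m⇒∣n (subst (2 ^ suc j ∣_) (sym p+2^j≡n) (∣-trans (2^-mono-∣ j<k) 2^k∣n)) 2^1+j∣p

-- Phrased with `IsValuation₂` rather than `v`, the claim is vacuous at n = 0, so the induction
-- carries no nonzero condition.
SG-valuation : ∀ n {k} → IsValuation₂ n k → SG n ≡ suc k
SG-valuation = <-rec (λ n → ∀ {k} → IsValuation₂ n k → SG n ≡ suc k) step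
  where
  step : ∀ n → (∀ {p} → p < n → ∀ {k} → IsValuation₂ p k → SG p ≡ suc k) →
         ∀ {k} → IsValuation₂ n k → SG n ≡ suc k
  step n ih {k} val = SG-unique (missed , reached)
    where
    option-avoids : ∀ p → p ∈ opt n → suc k ≢ SG p
    -- `SG 0` computes to 0, which is no successor.
    option-avoids zero    _  ()
    option-avoids (suc q) p∈ 1+k≡SG =
      option-changes-valuation p∈ val (subst (IsValuation₂ (suc q)) (sym k≡k′) val-p)
      where
      val-p : IsValuation₂ (suc q) (v (suc q))
      val-p = proj₂ (valuation∃ (suc q))

      -- The induction hypothesis turns equal Grundy values into equal valuations.
      k≡k′ : k ≡ v (suc q)
      k≡k′ = suc-injective (trans 1+k≡SG (ih (opt-< p∈) val-p))

    missed : suc k ∉ map SG (opt n)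
    missed 1+k∈ = let p , p∈ , 1+k≡SG = ∈-map⁻ SG 1+k∈ in option-avoids p p∈ 1+k≡SG

    reached : ∀ j → j < suc k → j ∈ map SG (opt n)
    -- Subtracting n itself leads to 0, whose value is 0.
    reached zero _ =
      ∈-map⁺ SG (Equivalence.from (∈-opt n 0) (n , IsValuation₂⇒>0 val , ∣-refl , refl))
    reached (suc j) 1+j<1+k =
      let p , p∈ , val-p = option-of-smaller-valuation val (s<s⁻¹ 1+j<1+k)
      in subst (_∈ map SG (opt n)) (ih (opt-< p∈) val-p) (∈-map⁺ SG p∈)

mainTheorem2 : SG 0 ≡ 0 ×
    (∀ (n : ℕ) .{{_ : NonZero n}} (k m : ℕ) → n ≡ 2 ^ k * m → 2 ∤ m →
    SG n ≡ v n + 1 × v n + 1 ≡ k + 1)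
mainTheorem2 = refl , λ { n k m n≡2^k*m 2∤m →
  trans (SG-valuation n (proj₂ (valuation∃ n))) (+-comm 1 (v n)) ,
  -- Both `v n` and the exponent k of the given factorisation are valuations of n, hence equal.
  cong (_+ 1) (IsValuation₂-unique (proj₂ (valuation∃ n))
    (subst (λ x → IsValuation₂ x k) (sym n≡2^k*m) (IsValuation₂-2^k*odd k 2∤m))) }
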